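{- Let $a\ne b$. The spherical tiling by $12$ edge congruent pentagons with edge lengths $a,a,a,b,b$ is, up to symmetries, given by the following assignment of lengths to the edges of the dodecahedral pattern: the edges $$E_{1,2},E_{1,3},E_{2,3},\;E_{4,8},E_{4,9},E_{8,9},\;E_{5,6},E_{5,10},E_{6,10},\;E_{7,11},E_{7,12},E_{11,12}$$ have length $b$, and all other edges have length $a$.
   Context: A spherical tiling by $12$ pentagons (graph embedded in $S^2$ with all vertices of degree $\ge 3$, every tile a five-edged region enclosed by a simple closed curve; edges may be any nice curves) is combinatorially the dodecahedral pattern: tiles $P_1,\dots,P_{12}$, where $P_i$ with list $(n_1,\dots,n_5)$ has edges in cyclic order $E_{i,n_1},\dots,E_{i,n_5}$, $E_{i,j}=E_{j,i}$ being the common edge of $P_i$ and $P_j$, and (with $n_6=n_1$) $E_{i,n_k},E_{i,n_{k+1}}$ meet at the vertex $V_{i,n_k,n_{k+1}}$ of degree $3$ shared by $P_i,P_{n_k},P_{n_{k+1}}$: $P_1:(2,3,4,5,6)$; $P_2:(1,6,11,7,3)$; $P_3:(1,2,7,8,4)$; $P_4:(1,3,8,9,5)$; $P_5:(1,4,9,10,6)$; $P_6:(1,5,10,11,2)$; $P_7:(12,8,3,2,11)$; $P_8:(12,9,4,3,7)$; $P_9:(12,10,5,4,8)$; $P_{10}:(12,11,6,5,9)$; $P_{11}:(12,7,2,6,10)$; $P_{12}:(7,11,10,9,8)$. An edge congruent tiling is considered as an assignment of lengths to the $30$ edges such that all tiles are edge congruent, i.e. for any two tiles there is an adjacency-preserving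 correspondence of their edges that preserves lengths. No geometric realization by great arcs is required. "Up to symmetries" means up to symmetries of the dodecahedral pattern (including reflections). -}

module Defs where

open import Data.Bool.Base using (if_then_else_)
open import Data.Empty using (⊥-elim-irr)
open import Data.Fin.Base using (Fin; suc; _<_)
open import Data.Fin.Patterns using (0F; 1F; 2F; 3F; 4F; 5F; 6F; 7F; 8F; 9F)
open import Data.Fin.Permutation using (Permutation′; _⟨$⟩ʳ_)
open import Data.Fin.Properties using (_≟_; <-cmp; all?)
open import Data.List.Base using (List; []; _∷_; tabulate)
open import Data.List.Relation.Binary.Permutation.Propositional using (_↭_)
open import Data.Product.Base using (_×_; _,_; Σ-syntax)
open import Data.Sum.Base using (_⊎_)
open import Data.Vec.Base using (Vec; []; _∷_; lookup)
open import Data.Vec.Membership.DecPropositional (_≟_ {12}) using (_∈_; _∈?_)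
open import Data.Vec.Membership.Propositional.Properties using (∈-lookup)
open import Data.Vec.Relation.Unary.Any using (index)
open import Data.Vec.Relation.Unary.Any.Properties using (lookup-index)
open import Level using (Level)
open import Relation.Binary.Definitions using (DecidableEquality; tri<; tri≈; tri>)
open import Relation.Binary.PropositionalEquality.Core using (_≡_; refl; sym; trans; cong; subst)
open import Relation.Nullary.Decidable
  using (Dec; yes; no; does; True; toWitness; fromWitness; from-yes; _→-dec_; ¬?)
open import Relation.Nullary.Negation using (¬_)

private
  variable
    ℓ : Level
    L : Set ℓ

Tile : Set
Tile = Fin 12

pattern P₁  = 0F
pattern P₂  = 1F
pattern P₃  = 2F
pattern P₄  = 3F
pattern P₅  = 4F
pattern P₆  = 5F
pattern P₇  = 6F
pattern P₈  = 7F
pattern P₉  = 8F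
pattern P₁₀ = 9F
pattern P₁₁ = suc 9F
pattern P₁₂ = suc (suc 9F)

-- The tiles across the five edges of a tile, in the cyclic order of the edges.
neighbours : Tile → Vec Tile 5
neighbours P₁  = P₂  ∷ P₃  ∷ P₄  ∷ P₅  ∷ P₆  ∷ []
neighbours P₂  = P₁  ∷ P₆  ∷ P₁₁ ∷ P₇  ∷ P₃  ∷ []
neighbours P₃  = P₁  ∷ P₂  ∷ P₇  ∷ P₈  ∷ P₄  ∷ []
neighbours P₄  = P₁  ∷ P₃  ∷ P₈  ∷ P₉  ∷ P₅  ∷ []
neighbours P₅  = P₁  ∷ P₄  ∷ P₉  ∷ P₁₀ ∷ P₆  ∷ []
neighbours P₆  = P₁  ∷ P₅  ∷ P₁₀ ∷ P₁₁ ∷ P₂  ∷ []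
neighbours P₇  = P₁₂ ∷ P₈  ∷ P₃  ∷ P₂  ∷ P₁₁ ∷ []
neighbours P₈  = P₁₂ ∷ P₉  ∷ P₄  ∷ P₃  ∷ P₇  ∷ []
neighbours P₉  = P₁₂ ∷ P₁₀ ∷ P₅  ∷ P₄  ∷ P₈  ∷ []
neighbours P₁₀ = P₁₂ ∷ P₁₁ ∷ P₆  ∷ P₅  ∷ P₉  ∷ []
neighbours P₁₁ = P₁₂ ∷ P₇  ∷ P₂  ∷ P₆  ∷ P₁₀ ∷ []
neighbours P₁₂ = P₇  ∷ P₁₁ ∷ P₁₀ ∷ P₉  ∷ P₈  ∷ []

infix 4 _~_ _~?_

_~_ : Tile → Tile → Set
i ~ j = j ∈ neighbours i

_~?_ : ∀ i j → Dec (i ~ j)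
i ~? j = j ∈? neighbours i

~-sym : ∀ i j → i ~ j → j ~ i
~-sym = from-yes (all? λ i → all? λ j → (i ~? j) →-dec (j ~? i))

~-irrefl : ∀ i → ¬ (i ~ i)
~-irrefl = from-yes (all? λ i → ¬? (i ~? i))

-- Two tiles share at most one edge, so an edge is an unordered pair of
-- adjacent tiles, stored with the smaller tile first.
record Edge : Set where
  constructor edge
  field
    lo hi     : Tile
    .ordered  : lo < hi
    .adjacent : lo ~ hi

open Edge public

infix 4 _≟ᴱ_

_≟ᴱ_ : DecidableEquality Edge
e ≟ᴱ e′ with lo e ≟ lo e′ | hi e ≟ hi e′
... | yes refl | yes refl = yes refl
... | no  l≢l′ | _        = no λ eq → l≢l′ (cong lo eq)
... | yes _    | no h≢h′  = no λ eq → h≢h′ (cong hi eq)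

common : ∀ i j → .(i ~ j) → Edge
common i j i~j with <-cmp i j
... | tri< i<j _ _    = edge i j i<j i~j
... | tri≈ _ refl _   = ⊥-elim-irr (~-irrefl i i~j)
... | tri> _ _ j<i    = edge j i j<i (~-sym i j i~j)

-- E i j and E j i are the same edge, since common sorts its arguments.
E : ∀ i j → {True (i ~? j)} → Edge
E i j {i~j} = common i j (toWitness i~j)

neighbour : Tile → Fin 5 → Tile
neighbour i k = lookup (neighbours i) k

side : Tile → Fin 5 → Edge
side i k = common i (neighbour i k) (∈-lookup k (neighbours i))

next : Fin 5 → Fin 5
next 0F = 1F
next 1F = 2F
next 2F = 3F
next 3F = 4F
next 4F = 0F

Consecutive : Fin 5 → Fin 5 → Set
Consecutive k l = next k ≡ l ⊎ next l ≡ k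

record Correspondence : Set where
  field
    perm      : Permutation′ 5
    preserves : ∀ k l → Consecutive k l → Consecutive (perm ⟨$⟩ʳ k) (perm ⟨$⟩ʳ l)

  to : Fin 5 → Fin 5
  to = perm ⟨$⟩ʳ_

-- Lengths are taken in an arbitrary type L: only their equality matters.
Assignment : Set ℓ → Set ℓ
Assignment L = Edge → L

EdgeCongruent : Assignment L → Set _
EdgeCongruent f =
  ∀ i j → Σ[ c ∈ Correspondence ] (∀ k → f (side i k) ≡ f (side j (Correspondence.to c k)))

-- The lengths are compared as multisets: no cyclic order is prescribed.
PentagonLengths : Assignment L → List L → Set _
PentagonLengths f ls = ∀ i → tabulate (λ k → f (side i k)) ↭ ls

-- A permutation of the tiles respecting the cyclic order of the edges of each
-- tile up to rotation and reflection. It therefore maps edges to edges and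
-- vertices (two consecutive edges of a tile) to vertices.
record Symmetry : Set where
  field
    perm           : Permutation′ 12
    correspondence : Tile → Correspondence
    compatible     : ∀ i k → perm ⟨$⟩ʳ neighbour i k
                             ≡ neighbour (perm ⟨$⟩ʳ i) (Correspondence.to (correspondence i) k)

  onTile : Tile → Tile
  onTile = perm ⟨$⟩ʳ_

  onTile-~ : ∀ {i j} → i ~ j → onTile i ~ onTile j
  onTile-~ {i} {j} i~j =
    subst (_∈ neighbours (onTile i))
      (sym (trans (cong onTile (lookup-index i~j)) (compatible i k)))
      (∈-lookup (Correspondence.to (correspondence i) k) (neighbours (onTile i)))
    where k = index i~j

  onEdge : Edge → Edge
  onEdge (edge i j _ i~j) = common (onTile i) (onTile j) (onTile-~ i~j)

EqualUpToSymmetry : Assignment L → Assignment L → Set _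
EqualUpToSymmetry f g = Σ[ σ ∈ Symmetry ] (∀ e → f e ≡ g (Symmetry.onEdge σ e))

bEdges : List Edge
bEdges = E P₁ P₂  ∷ E P₁ P₃  ∷ E P₂ P₃
       ∷ E P₄ P₈  ∷ E P₄ P₉  ∷ E P₈ P₉
       ∷ E P₅ P₆  ∷ E P₅ P₁₀ ∷ E P₆ P₁₀
       ∷ E P₇ P₁₁ ∷ E P₇ P₁₂ ∷ E P₁₁ P₁₂
       ∷ []

open import Data.List.Membership.DecPropositional _≟ᴱ_ using () renaming (_∈?_ to _∈ᴱ?_)

standard : L → L → Assignment L
standard a b e = if does (e ∈ᴱ? bEdges) then b else a

IsTiling : L → L → Assignment L → Set _
IsTiling a b f = EdgeCongruent f × PentagonLengths f (a ∷ a ∷ a ∷ b ∷ b ∷ [])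

{-# OPTIONS --safe #-}
-- Only the equality of lengths matters, so L may be replaced by Bool, with true
-- for b. A tiling is then a choice of two b-sides in each of the twelve tiles
-- such that adjacent tiles agree on their common edge and the two b-sides are
-- consecutive either in all tiles or in none. Backtracking tile by tile leaves
-- exactly ten choices (none with separated b-sides), and the ten symmetries of
-- the pattern that fix P₁ carry them to the standard one.
module Submission where

open import Defs
open import Data.Bool.Base using (Bool; true; false; if_then_else_)
open import Data.Bool.Properties using (if-float; ≤-decTotalOrder) renaming (_≟_ to _≟ᴮ_)
open import Data.Empty using (⊥-elim-irr)
open import Data.Fin.Base using (Fin; zero; suc; toℕ; _<_)
open import Data.Fin.Patterns using (0F; 1F; 2F; 3F; 4F)
open import Data.Fin.Permutation as Perm using (permutation; _∘ₚ_)
open import Data.Fin.Properties using (_≟_; <-cmp; all?; any?)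
open import Data.List.Base using (List; []; _∷_; filter; cartesianProductWith; map; tabulate)
open import Data.List.Membership.DecPropositional _≟ᴱ_ using () renaming (_∈?_ to _∈ᴱ?_)
open import Data.List.Membership.Propositional using () renaming (_∈_ to _∈ᴸ_)
open import Data.List.Membership.Propositional.Properties
  using (∈-filter⁺; ∈-cartesianProductWith⁺; ∈-map⁻)
open import Data.List.Properties using (≡-dec; map-tabulate; tabulate-cong; map-injective)
open import Data.List.Relation.Binary.Equality.Propositional using (≋⇒≡)
open import Data.List.Relation.Binary.Permutation.Propositional
  using (_↭_; ↭-sym; ↭-trans; ↭-reflexive)
open import Data.List.Relation.Binary.Permutation.Propositional.Properties
  using (map⁺; ↭-map-inv; All-resp-↭)
open import Data.List.Relation.Unary.All as All using (All; []; _∷_)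
open import Data.List.Relation.Unary.All.Properties using (tabulate⁻)
import Data.List.Relation.Unary.Any as Any
open import Data.List.Sort.InsertionSort.Base ≤-decTotalOrder using (insert; sort)
open import Data.List.Sort.InsertionSort.Properties ≤-decTotalOrder using (sort-↭; insert-swap)
open import Data.Nat.Base using (ℕ; zero; suc)
open import Data.Product.Base using (_×_; _,_; proj₁; proj₂; ∃-syntax)
open import Data.Sum.Base using (inj₁; inj₂)
open import Data.Unit.Base using (⊤; tt)
open import Data.Vec.Base as Vec using (Vec; []; _∷_; head; tail; lookup)
open import Data.Vec.Properties as Vec using (lookup∘tabulate)
open import Data.Vec.Relation.Unary.Any using (index)
open import Data.Vec.Relation.Unary.Any.Properties using (lookup-index)
open import Function.Base using (_∘_; id)
open import Function.Definitions using (Injective)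
open import Level using (Level)
open import Relation.Binary.Definitions using (tri<; tri≈; tri>)
open import Relation.Binary.PropositionalEquality
  using (_≡_; _≢_; _≗_; refl; sym; trans; cong; subst)
open import Relation.Nullary.Decidable
  using (Dec; yes; no; does; map′; recompute; from-yes; _→-dec_; _×-dec_; _⊎-dec_)
open import Relation.Nullary.Negation using (contradiction)

open import Data.List.Membership.DecPropositional (Vec.≡-dec {n = 12} (Vec.≡-dec {n = 5} _≟ᴮ_))
  using () renaming (_∈?_ to _∈ᴸ?_)

private
  variable
    ℓ m : Level
    A : Set
    L : Set ℓ
    M : Set m
    n : ℕ

-- Exhaustive search with early pruning

does-true : (a? : Dec A) → does a? ≡ true → A
does-true (yes a) refl = a

Constraint : ℕ → Set → Set₁
Constraint n A = Fin n → Fin n → A → A → Set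

-- C i j is tested for i < j only.
solve : List A → {C : Constraint n A} → (∀ i j x y → Dec (C i j x y)) → List (Vec A n)
solve {n = zero}  D C? = [] ∷ []
solve {n = suc n} D C? =
  filter (λ v → all? λ j → C? zero (suc j) (head v) (lookup (tail v) j))
    (cartesianProductWith _∷_ D (solve D λ i j → C? (suc i) (suc j)))

-- Candidates grow at the front, and each filter tests only the new head against the tail. A vector
-- meeting all constraints therefore passes every filter.
solve-complete : (D : List A) {C : Constraint n A} (C? : ∀ i j x y → Dec (C i j x y)) →
                 (v : Vec A n) → (∀ i → lookup v i ∈ᴸ D) →
                 (∀ i j → C i j (lookup v i) (lookup v j)) →
                 v ∈ᴸ solve D C?
solve-complete D C? []      v∈ ok = Any.here refl
solve-complete D C? (x ∷ v) v∈ ok =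
  ∈-filter⁺ (λ v → all? λ j → C? zero (suc j) (head v) (lookup (tail v) j))
    (∈-cartesianProductWith⁺ _∷_ (v∈ zero)
      (solve-complete D (λ i j → C? (suc i) (suc j)) v (v∈ ∘ suc) λ i j → ok (suc i) (suc j)))
    (λ j → ok zero (suc j))

-- Boolean lists up to permutation, and all Boolean vectors

sort-resp-↭ : ∀ {xs ys} → xs ↭ ys → sort xs ≡ sort ys
sort-resp-↭ _↭_.refl              = refl
sort-resp-↭ (_↭_.prep x p)        = cong (insert x) (sort-resp-↭ p)
sort-resp-↭ (_↭_.swap {xs} x y p) =
  trans (≋⇒≡ (insert-swap x y (sort xs))) (cong (insert y ∘ insert x) (sort-resp-↭ p))
sort-resp-↭ (_↭_.trans p q)       = trans (sort-resp-↭ p) (sort-resp-↭ q)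

infix 4 _↭?_

-- Insertion sort provides a normal form for multisets of Booleans, so equality of the sorted lists
-- decides the question.
_↭?_ : (xs ys : List Bool) → Dec (xs ↭ ys)
xs ↭? ys = map′
  (λ eq → ↭-trans (↭-sym (sort-↭ xs)) (↭-trans (↭-reflexive eq) (sort-↭ ys)))
  sort-resp-↭
  (≡-dec _≟ᴮ_ (sort xs) (sort ys))

vectors : ∀ n → List (Vec Bool n)
vectors n = solve {n = n} (true ∷ false ∷ []) {C = λ _ _ _ _ → ⊤} (λ _ _ _ _ → yes tt)

∈-vectors : (v : Vec Bool n) → v ∈ᴸ vectors n
∈-vectors v = solve-complete _ _ v (∈-bools ∘ lookup v) (λ _ _ → tt)
  where
  ∈-bools : ∀ b → b ∈ᴸ true ∷ false ∷ []
  ∈-bools true  = Any.here refl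
  ∈-bools false = Any.there (Any.here refl)

-- Dihedral correspondences and symmetries of the pattern

rotation : Correspondence
rotation = record
  { perm      = permutation next (next ∘ next ∘ next ∘ next) next⁵ next⁵
  ; preserves = λ { k l (inj₁ eq) → inj₁ (cong next eq)
                  ; k l (inj₂ eq) → inj₂ (cong next eq) }
  }
  where
  next⁵ : ∀ k → next (next (next (next (next k)))) ≡ k
  next⁵ = from-yes (all? λ k → next (next (next (next (next k)))) ≟ k)

reflection : Correspondence
reflection = record
  { perm      = permutation neg neg neg² neg²
  ; preserves = from-yes (all? λ k → all? λ l →
      (consecutive? k l) →-dec (consecutive? (neg k) (neg l)))
  }
  where
  neg : Fin 5 → Fin 5
  -- Negation modulo 5.
  neg = lookup (0F ∷ 4F ∷ 3F ∷ 2F ∷ 1F ∷ [])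

  neg² : ∀ k → neg (neg k) ≡ k
  neg² = from-yes (all? λ k → neg (neg k) ≟ k)

  consecutive? : ∀ k l → Dec (Consecutive k l)
  consecutive? k l = (next k ≟ l) ⊎-dec (next l ≟ k)

identity : Correspondence
identity = record { perm = Perm.id ; preserves = λ _ _ → id }

infixr 9 _∘ᶜ_ _∘ˢ_

_∘ᶜ_ : Correspondence → Correspondence → Correspondence
c ∘ᶜ d = record
  -- `∘ₚ` applies its left argument first.
  { perm      = perm d ∘ₚ perm c
  ; preserves = λ k l → preserves c _ _ ∘ preserves d k l
  }
  where open Correspondence

_∘ˢ_ : Symmetry → Symmetry → Symmetry
σ ∘ˢ τ = record
  { perm           = perm τ ∘ₚ perm σ
  ; correspondence = λ i → correspondence σ (onTile τ i) ∘ᶜ correspondence τ i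
  ; compatible     = λ i k → trans (cong (onTile σ) (compatible τ i k)) (compatible σ _ _)
  }
  where open Symmetry

iterate : ℕ → Correspondence → Correspondence
iterate zero    c = identity
iterate (suc n) c = c ∘ᶜ iterate n c

idˢ : Symmetry
idˢ = record { perm = Perm.id ; correspondence = λ _ → identity ; compatible = λ _ _ → refl }

-- turn and flip generate the symmetries fixing P₁, a dihedral group of order 10.
turn : Symmetry
turn = record
  { perm = permutation to from
      (from-yes (all? λ i → to (from i) ≟ i)) (from-yes (all? λ i → from (to i) ≟ i))
  ; correspondence = c
  ; compatible = from-yes (all? λ i → all? λ k →
      to (neighbour i k) ≟ neighbour (to i) (Correspondence.to (c i) k))
  }
  where
  to from : Tile → Tile
  to   = lookup (P₁ ∷ P₃ ∷ P₄ ∷ P₅ ∷ P₆ ∷ P₂ ∷ P₈ ∷ P₉ ∷ P₁₀ ∷ P₁₁ ∷ P₇ ∷ P₁₂ ∷ [])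
  from = to ∘ to ∘ to ∘ to

  c : Tile → Correspondence
  c P₁  = rotation
  -- `P₁₂` lists its neighbours against the direction of `turn`, hence the inverse rotation.
  c P₁₂ = iterate 4 rotation
  c _   = identity

flip : Symmetry
flip = record
  { perm = permutation to to to² to²
  ; correspondence = c
  ; compatible = from-yes (all? λ i → all? λ k →
      to (neighbour i k) ≟ neighbour (to i) (Correspondence.to (c i) k))
  }
  where
  to : Tile → Tile
  to = lookup (P₁ ∷ P₂ ∷ P₆ ∷ P₅ ∷ P₄ ∷ P₃ ∷ P₁₁ ∷ P₁₀ ∷ P₉ ∷ P₈ ∷ P₇ ∷ P₁₂ ∷ [])

  to² : ∀ i → to (to i) ≡ i
  to² = from-yes (all? λ i → to (to i) ≟ i)

  c : Tile → Correspondence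
  -- `flip` exchanges `P₇` and `P₁₁`, at positions 0 and 1 of `P₁₂`, so position k goes to 1 - k
  -- modulo 5.
  c P₁₂ = rotation ∘ᶜ reflection
  c _   = reflection

-- The standard b-edges are those meeting at the four vertices of an inscribed tetrahedron, one
-- vertex on each tile. Only the identity fixes both `P₁` and this tetrahedron, so these ten
-- symmetries give ten distinct images.
stabiliser : List Symmetry
stabiliser = idˢ ∷ turn ∷ turn² ∷ turn³ ∷ turn⁴
           ∷ flip ∷ flip ∘ˢ turn ∷ flip ∘ˢ turn² ∷ flip ∘ˢ turn³ ∷ flip ∘ˢ turn⁴ ∷ []
  where
  turn² turn³ turn⁴ : Symmetry
  turn² = turn ∘ˢ turn
  turn³ = turn ∘ˢ turn²
  turn⁴ = turn ∘ˢ turn³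

-- Edges as sides of tiles

common-ordered : ∀ {i j j′} → j′ ≡ j → .(i<j : i < j) .(i~j : i ~ j) .(i~j′ : i ~ j′) →
                 common i j′ i~j′ ≡ edge i j i<j i~j
common-ordered {i} {j} refl i<j i~j _ with <-cmp i j
... | tri< _ _ _    = refl
... | tri≈ i≮j _ _  = ⊥-elim-irr (i≮j i<j)
... | tri> i≮j _ _  = ⊥-elim-irr (i≮j i<j)

edge-side : ∀ e → ∃[ i ] ∃[ k ] side i k ≡ e
edge-side (edge i j i<j i~j) =
  -- The neighbour found by lookup equals `j` only propositionally, which is why `common-ordered`
  -- has a separate `j′`.
  i , index i~j′ , common-ordered (sym (lookup-index i~j′)) i<j i~j _
  where
  i~j′ : i ~ j
  -- The adjacency stored in an edge is irrelevant; deciding it again gives a proof from which an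
  -- index can be read.
  i~j′ = recompute (i ~? j) i~j

side-comm : ∀ i j k l → neighbour i k ≡ j → neighbour j l ≡ i → side i k ≡ side j l
side-comm = from-yes (all? λ i → all? λ j → all? λ k → all? λ l →
  (neighbour i k ≟ j) →-dec ((neighbour j l ≟ i) →-dec (side i k ≟ᴱ side j l)))

-- Constraints on the rows of a tiling

twoTrue : List Bool
twoTrue = false ∷ false ∷ false ∷ true ∷ true ∷ []

TwoTrue : Vec Bool 5 → Set
TwoTrue x = tabulate (lookup x) ↭ twoTrue

twoTrue? : ∀ x → Dec (TwoTrue x)
twoTrue? x = tabulate (lookup x) ↭? twoTrue

twoTrue-complete : ∀ x → TwoTrue x → x ∈ᴸ filter twoTrue? (vectors 5)
twoTrue-complete x = ∈-filter⁺ twoTrue? {xs = vectors 5} (∈-vectors x)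

ConsecutiveTrue : Vec Bool 5 → Set
ConsecutiveTrue x = ∃[ k ] (lookup x k ≡ true × lookup x (next k) ≡ true)

consecutiveTrue? : ∀ x → Dec (ConsecutiveTrue x)
consecutiveTrue? x = any? λ k → (lookup x k ≟ᴮ true) ×-dec (lookup x (next k) ≟ᴮ true)

-- The first part is the trace of edge congruence: two true sides are either consecutive or
-- separated. The second is the gluing condition, vacuous unless the tiles are adjacent.
Compatible : Constraint 12 (Vec Bool 5)
Compatible i j x y =
  ((ConsecutiveTrue x → ConsecutiveTrue y) × (ConsecutiveTrue y → ConsecutiveTrue x)) ×
  (∀ k l → neighbour i k ≡ j → neighbour j l ≡ i → lookup x k ≡ lookup y l)

compatible? : ∀ i j x y → Dec (Compatible i j x y)
compatible? i j x y =
  ((consecutiveTrue? x →-dec consecutiveTrue? y) ×-dec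
   (consecutiveTrue? y →-dec consecutiveTrue? x)) ×-dec
  (all? λ k → all? λ l →
    (neighbour i k ≟ j) →-dec ((neighbour j l ≟ i) →-dec (lookup x k ≟ᴮ lookup y l)))

sides : Assignment Bool → Vec (Vec Bool 5) 12
sides f = Vec.tabulate λ i → Vec.tabulate (f ∘ side i)

lookup-sides : ∀ f i k → lookup (lookup (sides f) i) k ≡ f (side i k)
lookup-sides f i k = trans
  (cong (λ x → lookup x k) (lookup∘tabulate (λ i → Vec.tabulate (f ∘ side i)) i))
  (lookup∘tabulate (f ∘ side i) k)

-- A correspondence keeps consecutive sides consecutive but may reverse their order; in that case
-- the image of the second side starts the pair.
sides-consecutive : ∀ f → EdgeCongruent f → ∀ i j →
                    ConsecutiveTrue (lookup (sides f) i) → ConsecutiveTrue (lookup (sides f) j)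
sides-consecutive f congruent i j (k , eq , eq′) =
  consecutive (preserves k (next k) (inj₁ refl))
  where
  open Correspondence (proj₁ (congruent i j)) using (to; preserves)

  s : Tile → Fin 5 → Bool
  s i k = lookup (lookup (sides f) i) k

  true-to : ∀ k → s i k ≡ true → s j (to k) ≡ true
  true-to k eq = trans (lookup-sides f j (to k))
    (trans (sym (proj₂ (congruent i j) k)) (trans (sym (lookup-sides f i k)) eq))

  consecutive : Consecutive (to k) (to (next k)) → ConsecutiveTrue (lookup (sides f) j)
  consecutive (inj₁ p) =
    to k , true-to k eq , subst (λ l → s j l ≡ true) (sym p) (true-to (next k) eq′)
  consecutive (inj₂ p) =
    to (next k) , true-to (next k) eq′ , subst (λ l → s j l ≡ true) (sym p) (true-to k eq)

sides-compatible : ∀ f → EdgeCongruent f → ∀ i j →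
                   Compatible i j (lookup (sides f) i) (lookup (sides f) j)
sides-compatible f congruent i j =
    (sides-consecutive f congruent i j , sides-consecutive f congruent j i)
  , λ k l p q → trans (lookup-sides f i k)
      (trans (cong f (side-comm i j k l p q)) (sym (lookup-sides f j l)))

sides-twoTrue : ∀ f → PentagonLengths f twoTrue → ∀ i → TwoTrue (lookup (sides f) i)
sides-twoTrue f lengths i =
  ↭-trans (↭-reflexive (tabulate-cong (lookup-sides f i))) (lengths i)

sides-solve : ∀ D → (∀ x → TwoTrue x → x ∈ᴸ D) →
              ∀ f → IsTiling false true f → sides f ∈ᴸ solve D compatible?
sides-solve D D-complete f (congruent , lengths) = solve-complete D compatible? (sides f)
  (λ i → D-complete _ (sides-twoTrue f lengths i)) (sides-compatible f congruent)

-- Existence and uniqueness for Boolean lengths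

standardᴮ : Assignment Bool
standardᴮ = standard false true

image : Symmetry → Vec (Vec Bool 5) 12
image σ = sides (standardᴮ ∘ Symmetry.onEdge σ)

-- Every edge is a side of some tile, so the rows determine the assignment.
image-equal : ∀ f σ → sides f ≡ image σ → EqualUpToSymmetry f standardᴮ
image-equal f σ eq = σ , λ e → let i , k , side≡e = edge-side e in
  subst (λ e → f e ≡ g e) side≡e
    (trans (sym (lookup-sides f i k))
      (trans (cong (λ v → lookup (lookup v i) k) eq) (lookup-sides g i k)))
  where
  g : Assignment Bool
  g = standardᴮ ∘ Symmetry.onEdge σ

infix 4 _⊆?_

_⊆?_ : ∀ vs ws → Dec (All (_∈ᴸ ws) vs)
vs ⊆? ws = All.all? (_∈ᴸ? ws) vs

-- D and σs are kept generic so that the search is evaluated once only, when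
-- refl is checked in standardᴮ-unique.
search-equal : ∀ D → (∀ x → TwoTrue x → x ∈ᴸ D) →
               ∀ σs → does (solve D compatible? ⊆? map image σs) ≡ true →
               ∀ f → IsTiling false true f → EqualUpToSymmetry f standardᴮ
search-equal D D-complete σs eq f tiling =
  let solved⊆images = does-true (solve D compatible? ⊆? map image σs) eq
      σ , _ , sides≡ = ∈-map⁻ image (All.lookup solved⊆images (sides-solve D D-complete f tiling))
  in image-equal f σ sides≡

standardᴮ-unique : ∀ f → IsTiling false true f → EqualUpToSymmetry f standardᴮ
standardᴮ-unique = search-equal (filter twoTrue? (vectors 5)) twoTrue-complete stabiliser refl

-- In each tile the two true sides are consecutive, so a rotation already aligns any two rows.
standardᴮ-tiling : IsTiling false true standardᴮ
standardᴮ-tiling =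
    (λ i j → let n , eq = rotated i j in iterate (toℕ n) rotation , eq)
  , from-yes (all? λ i → tabulate (standardᴮ ∘ side i) ↭? twoTrue)
  where
  rotated : ∀ i j → ∃[ n ] ∀ k → standardᴮ (side i k) ≡
            standardᴮ (side j (Correspondence.to (iterate (toℕ {5} n) rotation) k))
  rotated = from-yes (all? λ i → all? λ j → any? λ n → all? λ k →
    standardᴮ (side i k) ≟ᴮ
    standardᴮ (side j (Correspondence.to (iterate (toℕ {5} n) rotation) k)))

-- Transfer from Boolean to arbitrary lengths

module _ (φ : L → M) {x y : L} {f : Assignment M} {g : Assignment L} (f≗φ∘g : f ≗ φ ∘ g) where

  private
    tabulate-f : ∀ i → tabulate (f ∘ side i) ≡ map φ (tabulate (g ∘ side i))
    tabulate-f i = trans (tabulate-cong (f≗φ∘g ∘ side i)) (sym (map-tabulate (g ∘ side i) φ))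

  IsTiling-map : IsTiling x y g → IsTiling (φ x) (φ y) f
  IsTiling-map (congruent , lengths) =
      (λ i j → let c , eq = congruent i j in
        c , λ k → trans (f≗φ∘g _) (trans (cong φ (eq k)) (sym (f≗φ∘g _))))
    , (λ i → ↭-trans (↭-reflexive (tabulate-f i)) (map⁺ φ (lengths i)))

  IsTiling-map⁻ : Injective _≡_ _≡_ φ → IsTiling (φ x) (φ y) f → IsTiling x y g
  IsTiling-map⁻ φ-injective (congruent , lengths) =
      (λ i j → let c , eq = congruent i j in
        c , λ k → φ-injective (trans (sym (f≗φ∘g _)) (trans (eq k) (f≗φ∘g _))))
    -- The permutation lifts to one onto some `ys` whose image under `φ` is the prescribed list;
    -- injectivity then identifies `ys`.
    , (λ i → let ys , eq , p = ↭-map-inv φ (↭-trans (↭-reflexive (sym (tabulate-f i))) (lengths i)) in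
        ↭-trans p (↭-reflexive (sym (map-injective φ-injective eq))))

EqualUpToSymmetry-map : (φ : L → M) {f f′ : Assignment M} {g g′ : Assignment L} →
                        f ≗ φ ∘ g → f′ ≗ φ ∘ g′ → EqualUpToSymmetry g g′ → EqualUpToSymmetry f f′
EqualUpToSymmetry-map φ f≗ f′≗ (σ , eq) =
  σ , λ e → trans (f≗ e) (trans (cong φ (eq e)) (sym (f′≗ (Symmetry.onEdge σ e))))

proposition10 : ∀ {ℓ : Level} {L : Set ℓ} (a b : L) → a ≢ b →
    IsTiling a b (standard a b) ×
    (∀ (f : Assignment L) → IsTiling a b f → EqualUpToSymmetry f (standard a b))
proposition10 {L = L} a b a≢b = IsTiling-map φ {false} {true} standard≗ standardᴮ-tiling , unique
  where
  φ : Bool → L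
  φ c = if c then b else a

  φ-injective : Injective _≡_ _≡_ φ
  φ-injective {false} {false} _  = refl
  φ-injective {false} {true}  eq = contradiction eq a≢b
  φ-injective {true}  {false} eq = contradiction (sym eq) a≢b
  φ-injective {true}  {true}  _  = refl

  standard≗ : standard a b ≗ φ ∘ standardᴮ
  standard≗ e = sym (if-float φ (does (e ∈ᴱ? bEdges)) {true} {false})

  unique : ∀ f → IsTiling a b f → EqualUpToSymmetry f (standard a b)
  unique f tiling@(_ , lengths) =
    EqualUpToSymmetry-map φ f≗φ∘g standard≗
      (standardᴮ-unique g (IsTiling-map⁻ φ {false} {true} f≗φ∘g φ-injective tiling))
    where
    -- Equality in `L` need not be decidable, so the Boolean is read off from the permutation of a,
    -- a, a, b, b on a tile containing the edge.
    a-or-b : ∀ e → ∃[ c ] f e ≡ φ c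
    a-or-b e = let i , k , side≡e = edge-side e in
      subst (λ e → ∃[ c ] f e ≡ φ c) side≡e
        (tabulate⁻ {P = λ x → ∃[ c ] x ≡ φ c} {f = f ∘ side i}
          (All-resp-↭ (↭-sym (lengths i)) values) k)
      where
      values : All (λ x → ∃[ c ] x ≡ φ c) (a ∷ a ∷ a ∷ b ∷ b ∷ [])
      values = (false , refl) ∷ (false , refl) ∷ (false , refl) ∷ (true , refl) ∷ (true , refl) ∷ []

    g : Assignment Bool
    g = proj₁ ∘ a-or-b

    f≗φ∘g : f ≗ φ ∘ g
    f≗φ∘g = proj₂ ∘ a-or-b
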